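{- The logics $\mathrm{C}$, $\mathrm{C3}$, $\mathrm{MC}$ and $\mathrm{CN}$, given by the sequent calculi $\mathrm{sC}$, $\mathrm{sC3}$, $\mathrm{sMC}$ and $\mathrm{sCN}$ respectively, are pairwise not logically equivalent; that is, for any two distinct calculi among these four, the sets of sequents provable in them are different.
   Context: Formulas are built from countably many propositional variables $p,q,\dots$ using the binary connectives $\land,\lor,\to$ and the unary connective $\sim$. A sequent is an expression $\Gamma\Rightarrow\gamma$ with $\Gamma$ a finite (possibly empty) set of formulas and $\gamma$ a single formula; $\alpha,\Gamma$ means $\{\alpha\}\cup\Gamma$ and $\Gamma,\Delta$ means $\Gamma\cup\Delta$. The calculus $\mathrm{sC}$ has the following initial sequents and rules ($p$ any propositional variable; $\alpha,\beta,\gamma$ any formulas; $\Gamma,\Delta,\Sigma$ any finite sets of formulas). Initial sequents: (init1) $p,\Gamma\Rightarrow p$; (init2) $\sim p,\Gamma\Rightarrow\sim p$. (cut): from $\Gamma\Rightarrow\alpha$ and $\alpha,\Sigma\Rightarrow\gamma$ infer $\Gamma,\Sigma\Rightarrow\gamma$. ($\to$left): from $\Gamma\Rightarrow\alpha$ and $\beta,\Delta\Rightarrow\gamma$ infer $\alpha\to\beta,\Gamma,\Delta\Rightarrow\gamma$. ($\to$right): from $\alpha,\Gamma\Rightarrow\beta$ infer $\Gamma\Rightarrow\alpha\to\beta$. ($\land$left): from $\alpha,\beta,\Gamma\Rightarrow\gamma$ infer $\alpha\land\beta,\Gamma\Rightarrow\gamma$. ($\land$right): from $\Gamma\Rightarrow\alpha$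 and $\Gamma\Rightarrow\beta$ infer $\Gamma\Rightarrow\alpha\land\beta$. ($\lor$left): from $\alpha,\Gamma\Rightarrow\gamma$ and $\beta,\Gamma\Rightarrow\gamma$ infer $\alpha\lor\beta,\Gamma\Rightarrow\gamma$. ($\lor$right1), ($\lor$right2): from $\Gamma\Rightarrow\alpha$ (respectively $\Gamma\Rightarrow\beta$) infer $\Gamma\Rightarrow\alpha\lor\beta$. ($\sim$left): from $\alpha,\Gamma\Rightarrow\gamma$ infer $\sim\sim\alpha,\Gamma\Rightarrow\gamma$. ($\sim$right): from $\Gamma\Rightarrow\alpha$ infer $\Gamma\Rightarrow\sim\sim\alpha$. ($\sim\to$left): from $\Gamma\Rightarrow\alpha$ and $\sim\beta,\Delta\Rightarrow\gamma$ infer $\sim(\alpha\to\beta),\Gamma,\Delta\Rightarrow\gamma$. ($\sim\to$right): from $\alpha,\Gamma\Rightarrow\sim\beta$ infer $\Gamma\Rightarrow\sim(\alpha\to\beta)$. ($\sim\land$left): from $\sim\alpha,\Gamma\Rightarrow\gamma$ and $\sim\beta,\Gamma\Rightarrow\gamma$ infer $\sim(\alpha\land\beta),\Gamma\Rightarrow\gamma$. ($\sim\land$right1), ($\sim\land$right2): from $\Gamma\Rightarrow\sim\alpha$ (respectively $\Gamma\Rightarrow\sim\beta$) infer $\Gamma\Rightarrow\sim(\alpha\land\beta)$. ($\sim\lor$left): from $\sim\alpha,\sim\beta,\Gamma\Rightarrow\gamma$ infer $\sim(\alpha\lor\beta),\Gamma\Rightarrow\gamma$. ($\sim\lor$right):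 from $\Gamma\Rightarrow\sim\alpha$ and $\Gamma\Rightarrow\sim\beta$ infer $\Gamma\Rightarrow\sim(\alpha\lor\beta)$. Additional rules: (ex-middle): from $\sim\alpha,\Gamma\Rightarrow\gamma$ and $\alpha,\Gamma\Rightarrow\gamma$ infer $\Gamma\Rightarrow\gamma$. (Peirce): from $\alpha\to\beta,\Gamma\Rightarrow\alpha$ infer $\Gamma\Rightarrow\alpha$. $\mathrm{sC3}=\mathrm{sC}+$(ex-middle); $\mathrm{sMC}=\mathrm{sC}+$(Peirce); $\mathrm{sCN}=\mathrm{sC3}+$(Peirce). -}

module Defs where

open import Data.List.Base using (List; _∷_; _++_)
open import Data.List.Relation.Binary.BagAndSetEquality using (_∼[_]_; set)
open import Data.Nat.Base using (ℕ)
open import Level using (0ℓ)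
open import Relation.Unary using (Pred)

infix  9 ~_
infixr 8 _∧_
infixr 7 _∨_
infixr 6 _⟶_
infix  4 _⇒_

data Formula : Set where
  var         : ℕ → Formula
  _∧_ _∨_ _⟶_ : Formula → Formula → Formula
  ~_          : Formula → Formula

-- A finite set of formulas is presented by a list of its elements, in any
-- order and with any repetitions; `_∼[ set ]_` is equality of the presented
-- sets, and `_++_` presents their union.
record Sequent : Set where
  constructor _⇒_
  field
    antecedent : List Formula
    succedent  : Formula

data Calculus : Set where
  sC sC3 sMC sCN : Calculus

data HasExMiddle : Calculus → Set where
  sC3 : HasExMiddle sC3
  sCN : HasExMiddle sCN

data HasPeirce : Calculus → Set where
  sMC : HasPeirce sMC
  sCN : HasPeirce sCN

private
  variable
    p     : ℕ
    α β γ : Formula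
    Γ Δ Σ : List Formula

data Provable (c : Calculus) : Pred Sequent 0ℓ where

  -- Not a rule of the calculus: it identifies the presentations of one and
  -- the same sequent. It cannot add or remove elements, so it does not amount
  -- to weakening.
  set-eq   : Γ ∼[ set ] Δ → Provable c (Γ ⇒ γ) → Provable c (Δ ⇒ γ)

  init1    : Provable c (var p ∷ Γ ⇒ var p)
  init2    : Provable c (~ var p ∷ Γ ⇒ ~ var p)

  cut      : Provable c (Γ ⇒ α) → Provable c (α ∷ Σ ⇒ γ) →
             Provable c (Γ ++ Σ ⇒ γ)

  ⟶left    : Provable c (Γ ⇒ α) → Provable c (β ∷ Δ ⇒ γ) →
             Provable c (α ⟶ β ∷ Γ ++ Δ ⇒ γ)
  ⟶right   : Provable c (α ∷ Γ ⇒ β) → Provable c (Γ ⇒ α ⟶ β)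

  ∧left    : Provable c (α ∷ β ∷ Γ ⇒ γ) → Provable c (α ∧ β ∷ Γ ⇒ γ)
  ∧right   : Provable c (Γ ⇒ α) → Provable c (Γ ⇒ β) →
             Provable c (Γ ⇒ α ∧ β)

  ∨left    : Provable c (α ∷ Γ ⇒ γ) → Provable c (β ∷ Γ ⇒ γ) →
             Provable c (α ∨ β ∷ Γ ⇒ γ)
  ∨right1  : Provable c (Γ ⇒ α) → Provable c (Γ ⇒ α ∨ β)
  ∨right2  : Provable c (Γ ⇒ β) → Provable c (Γ ⇒ α ∨ β)

  ~left    : Provable c (α ∷ Γ ⇒ γ) → Provable c (~ ~ α ∷ Γ ⇒ γ)
  ~right   : Provable c (Γ ⇒ α) → Provable c (Γ ⇒ ~ ~ α)

  ~⟶left   : Provable c (Γ ⇒ α) → Provable c (~ β ∷ Δ ⇒ γ) →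
             Provable c (~ (α ⟶ β) ∷ Γ ++ Δ ⇒ γ)
  ~⟶right  : Provable c (α ∷ Γ ⇒ ~ β) → Provable c (Γ ⇒ ~ (α ⟶ β))

  ~∧left   : Provable c (~ α ∷ Γ ⇒ γ) → Provable c (~ β ∷ Γ ⇒ γ) →
             Provable c (~ (α ∧ β) ∷ Γ ⇒ γ)
  ~∧right1 : Provable c (Γ ⇒ ~ α) → Provable c (Γ ⇒ ~ (α ∧ β))
  ~∧right2 : Provable c (Γ ⇒ ~ β) → Provable c (Γ ⇒ ~ (α ∧ β))

  ~∨left   : Provable c (~ α ∷ ~ β ∷ Γ ⇒ γ) → Provable c (~ (α ∨ β) ∷ Γ ⇒ γ)
  ~∨right  : Provable c (Γ ⇒ ~ α) → Provable c (Γ ⇒ ~ β) →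
             Provable c (Γ ⇒ ~ (α ∨ β))

  ex-middle : HasExMiddle c →
              Provable c (~ α ∷ Γ ⇒ γ) → Provable c (α ∷ Γ ⇒ γ) →
              Provable c (Γ ⇒ γ)

  peirce    : HasPeirce c →
              Provable c (α ⟶ β ∷ Γ ⇒ α) → Provable c (Γ ⇒ α)

{-# OPTIONS --safe #-}

-- Read a formula in a Kripke model with two independent persistent valuations,
-- one for truth and one for falsity, where α ⟶ β is false at a world iff every
-- later world verifying α falsifies β. The calculus sC is sound for all such
-- models.
--
-- In a one-world model forcing is decidable, so (Peirce) is sound; with a
-- variable neither true nor false there, ⇒ p ∨ ~ p is refuted. In a two-world
-- chain where every variable is false everywhere, each formula is true or false
-- at each world, so (ex-middle) is sound; with p true at the top world only and
-- q true nowhere, Peirce's law is refuted at the bottom.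
module Submission where

open import Data.Bool.Base as Bool using (Bool; true; false; f≤t; b≤b)
open import Data.Bool.Properties using (≤-refl; ≤-trans)
open import Data.Empty using (⊥)
open import Data.List.Base using ([]; _∷_; [_])
open import Data.List.Relation.Binary.BagAndSetEquality using (bag-=⇒; ↭⇒∼bag)
open import Data.List.Relation.Binary.Permutation.Propositional using (↭-refl; ↭-swap)
open import Data.List.Relation.Unary.All as All using (All; []; _∷_)
open import Data.List.Relation.Unary.All.Properties using (++⁻ˡ; ++⁻ʳ; anti-mono)
open import Data.Nat.Base using (ℕ; zero; suc)
open import Data.Product.Base using (_×_; _,_)
open import Data.Sum.Base as Sum using (_⊎_; inj₁; inj₂; [_,_]′)
open import Data.Unit.Base using (⊤; tt)
open import Defs
open import Function.Base using (_∘_; id)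
open import Function.Bundles using (module Equivalence)
open import Relation.Binary.PropositionalEquality using (_≢_; refl)
open import Relation.Nullary using (¬_)
open import Relation.Nullary.Decidable using (Dec; yes; no; _×-dec_; _⊎-dec_; _→-dec_; map′)
open import Relation.Nullary.Negation using (contradiction)
open import Relation.Unary using (_≐_)
open import Relation.Unary.Properties using (≐-sym)

record Model : Set₁ where
  infix 4 _≤_
  field
    World      : Set
    _≤_        : World → World → Set
    reflexive  : ∀ {w} → w ≤ w
    transitive : ∀ {u v w} → u ≤ v → v ≤ w → u ≤ w
    true-at false-at : ℕ → World → Set
    true-mono  : ∀ n {v w} → v ≤ w → true-at n v → true-at n w
    false-mono : ∀ n {v w} → v ≤ w → false-at n v → false-at n w

module Forcing (M : Model) where
  open Model M

  infix 4 _⊩_ _⊩⁻_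

  _⊩_ _⊩⁻_ : World → Formula → Set
  w ⊩ var n   = true-at n w
  w ⊩ α ∧ β   = w ⊩ α × w ⊩ β
  w ⊩ α ∨ β   = w ⊩ α ⊎ w ⊩ β
  w ⊩ α ⟶ β   = ∀ {v} → w ≤ v → v ⊩ α → v ⊩ β
  w ⊩ ~ α     = w ⊩⁻ α
  w ⊩⁻ var n  = false-at n w
  w ⊩⁻ α ∧ β  = w ⊩⁻ α ⊎ w ⊩⁻ β
  w ⊩⁻ α ∨ β  = w ⊩⁻ α × w ⊩⁻ β
  w ⊩⁻ α ⟶ β  = ∀ {v} → w ≤ v → v ⊩ α → v ⊩⁻ β
  w ⊩⁻ ~ α    = w ⊩ α

  ⊩-mono  : ∀ α {v w} → v ≤ w → v ⊩ α → w ⊩ α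
  ⊩⁻-mono : ∀ α {v w} → v ≤ w → v ⊩⁻ α → w ⊩⁻ α
  ⊩-mono (var n) v≤w t        = true-mono n v≤w t
  ⊩-mono (α ∧ β) v≤w (a , b)  = ⊩-mono α v≤w a , ⊩-mono β v≤w b
  ⊩-mono (α ∨ β) v≤w          = Sum.map (⊩-mono α v≤w) (⊩-mono β v≤w)
  ⊩-mono (α ⟶ β) v≤w f w≤u    = f (transitive v≤w w≤u)
  ⊩-mono (~ α)   v≤w          = ⊩⁻-mono α v≤w
  ⊩⁻-mono (var n) v≤w t       = false-mono n v≤w t
  ⊩⁻-mono (α ∧ β) v≤w         = Sum.map (⊩⁻-mono α v≤w) (⊩⁻-mono β v≤w)
  ⊩⁻-mono (α ∨ β) v≤w (a , b) = ⊩⁻-mono α v≤w a , ⊩⁻-mono β v≤w b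
  ⊩⁻-mono (α ⟶ β) v≤w f w≤u   = f (transitive v≤w w≤u)
  ⊩⁻-mono (~ α)   v≤w         = ⊩-mono α v≤w

  ⊩*-mono : ∀ {Γ v w} → v ≤ w → All (v ⊩_) Γ → All (w ⊩_) Γ
  ⊩*-mono v≤w = All.map (λ {α} → ⊩-mono α v≤w)

  ExMiddle Peirce : Set
  ExMiddle = ∀ α {w} → w ⊩ α ⊎ w ⊩⁻ α
  Peirce   = ∀ α β {w} → (w ⊩ α ⟶ β → w ⊩ α) → w ⊩ α

  module _ {c : Calculus} (em : HasExMiddle c → ExMiddle) (pc : HasPeirce c → Peirce) where

    -- Induction on the derivation. The right rules for implication move to a later world, so
    -- persistence must carry the antecedent there. `em` and `pc` are conditional on `c` having the
    -- rule, so one proof serves all four calculi.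
    sound : ∀ {Γ γ w} → Provable c (Γ ⇒ γ) → All (w ⊩_) Γ → w ⊩ γ
    sound (set-eq Γ∼Δ d) ρ =
      sound d (anti-mono (Equivalence.to Γ∼Δ) ρ)
    sound init1 (a ∷ _) = a
    sound init2 (a ∷ _) = a
    sound (cut {Γ = Γ} d e) ρ = sound e (sound d (++⁻ˡ Γ ρ) ∷ ++⁻ʳ Γ ρ)
    sound (⟶left {Γ = Γ} d e) (f ∷ ρ) =
      sound e (f reflexive (sound d (++⁻ˡ Γ ρ)) ∷ ++⁻ʳ Γ ρ)
    sound (⟶right d) ρ w≤v a = sound d (a ∷ ⊩*-mono w≤v ρ)
    sound (∧left d) ((a , b) ∷ ρ) = sound d (a ∷ b ∷ ρ)
    sound (∧right d e) ρ = sound d ρ , sound e ρ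
    sound (∨left d e) (inj₁ a ∷ ρ) = sound d (a ∷ ρ)
    sound (∨left d e) (inj₂ b ∷ ρ) = sound e (b ∷ ρ)
    sound (∨right1 d) ρ = inj₁ (sound d ρ)
    sound (∨right2 d) ρ = inj₂ (sound d ρ)
    sound (~left d) (a ∷ ρ) = sound d (a ∷ ρ)
    sound (~right d) ρ = sound d ρ
    sound (~⟶left {Γ = Γ} d e) (f ∷ ρ) =
      sound e (f reflexive (sound d (++⁻ˡ Γ ρ)) ∷ ++⁻ʳ Γ ρ)
    sound (~⟶right d) ρ w≤v a = sound d (a ∷ ⊩*-mono w≤v ρ)
    sound (~∧left d e) (inj₁ a ∷ ρ) = sound d (a ∷ ρ)
    sound (~∧left d e) (inj₂ b ∷ ρ) = sound e (b ∷ ρ)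
    sound (~∧right1 d) ρ = inj₁ (sound d ρ)
    sound (~∧right2 d) ρ = inj₂ (sound d ρ)
    sound (~∨left d) ((a , b) ∷ ρ) = sound d (a ∷ b ∷ ρ)
    sound (~∨right d e) ρ = sound d ρ , sound e ρ
    sound (ex-middle {α = α} h d e) ρ =
      [ (λ a → sound e (a ∷ ρ)) , (λ a → sound d (a ∷ ρ)) ]′ (em h α)
    sound (peirce {α = α} {β = β} h d) ρ =
      pc h α β (λ (f : _ ⊩ α ⟶ β) → sound d ((λ {v} → f {v}) ∷ ρ))

exMiddleLaw peirceLaw : Sequent
exMiddleLaw = [] ⇒ var 0 ∨ ~ var 0
peirceLaw   = [] ⇒ ((var 0 ⟶ var 1) ⟶ var 0) ⟶ var 0

exMiddleLaw-provable : ∀ {c} → HasExMiddle c → Provable c exMiddleLaw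
exMiddleLaw-provable h = ex-middle h (∨right2 init2) (∨right1 init1)

-- (Peirce) adds `var 0 ⟶ var 1` to the antecedent, and `⟶left` then feeds it to the hypothesis.
-- Initial sequents cover only literals, so the identity on this implication is derived first.
peirceLaw-provable : ∀ {c} → HasPeirce c → Provable c peirceLaw
peirceLaw-provable {c} h =
  ⟶right (peirce h (swap (⟶left {Γ = [ var 0 ⟶ var 1 ]} identity init1)))
  where
  swap : ∀ {α β γ} → Provable c (α ∷ β ∷ [] ⇒ γ) → Provable c (β ∷ α ∷ [] ⇒ γ)
  swap {α} {β} = set-eq (bag-=⇒ (↭⇒∼bag (↭-swap α β ↭-refl)))

  identity : Provable c ([ var 0 ⟶ var 1 ] ⇒ var 0 ⟶ var 1)
  identity = ⟶right (swap (⟶left {Γ = [ var 0 ]} init1 init1))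

module Valueless where

  model : Model
  model = record
    { World = ⊤ ; _≤_ = λ _ _ → ⊤ ; reflexive = tt ; transitive = λ _ _ → tt
    ; true-at  = λ _ _ → ⊥ ; true-mono  = λ _ _ → id
    ; false-at = λ _ _ → ⊥ ; false-mono = λ _ _ → id
    }

  open Forcing model

  -- With a single world the quantifier over later worlds collapses, so an implication is decided
  -- from its two parts.
  ⊩?  : ∀ α → Dec (tt ⊩ α)
  ⊩⁻? : ∀ α → Dec (tt ⊩⁻ α)
  ⊩? (var n)  = no λ ()
  ⊩? (α ∧ β)  = ⊩? α ×-dec ⊩? β
  ⊩? (α ∨ β)  = ⊩? α ⊎-dec ⊩? β
  ⊩? (α ⟶ β)  = map′ (λ f _ → f) (λ f → f tt) (⊩? α →-dec ⊩? β)
  ⊩? (~ α)    = ⊩⁻? α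
  ⊩⁻? (var n) = no λ ()
  ⊩⁻? (α ∧ β) = ⊩⁻? α ⊎-dec ⊩⁻? β
  ⊩⁻? (α ∨ β) = ⊩⁻? α ×-dec ⊩⁻? β
  ⊩⁻? (α ⟶ β) = map′ (λ f _ → f) (λ f → f tt) (⊩? α →-dec ⊩⁻? β)
  ⊩⁻? (~ α)   = ⊩? α

  peirce-valid : Peirce
  peirce-valid α β f with ⊩? α
  ... | yes a = a
  -- `α` fails at the only world, so `α ⟶ β` holds vacuously there.
  ... | no ¬a = f (λ _ a → contradiction a ¬a)

  exMiddleLaw-unprovable : ∀ {c} → ¬ HasExMiddle c → ¬ Provable c exMiddleLaw
  exMiddleLaw-unprovable ¬h d
    with sound (λ h → contradiction h ¬h) (λ _ → peirce-valid) d []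
  ... | inj₁ ()
  ... | inj₂ ()

module Chain where

  model : Model
  model = record
    { World = Bool ; _≤_ = Bool._≤_ ; reflexive = ≤-refl ; transitive = ≤-trans
    ; true-at  = true-at ; true-mono = true-mono
    ; false-at = λ _ _ → ⊤ ; false-mono = λ _ _ → id
    }
    where
    true-at : ℕ → Bool → Set
    true-at zero    w = Bool.T w
    true-at (suc _) _ = ⊥

    true-mono : ∀ n {v w} → v Bool.≤ w → true-at n v → true-at n w
    true-mono _    b≤b t = t
    true-mono zero f≤t _ = tt

  open Forcing model

  exMiddle-valid : ExMiddle
  exMiddle-valid (var n) = inj₂ tt
  exMiddle-valid (α ∧ β) with exMiddle-valid α | exMiddle-valid β
  ... | inj₁ a | inj₁ b = inj₁ (a , b)
  ... | inj₂ a | _      = inj₂ (inj₁ a)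
  ... | _      | inj₂ b = inj₂ (inj₂ b)
  exMiddle-valid (α ∨ β) with exMiddle-valid α | exMiddle-valid β
  ... | inj₂ a | inj₂ b = inj₂ (a , b)
  ... | inj₁ a | _      = inj₁ (inj₁ a)
  ... | _      | inj₁ b = inj₁ (inj₂ b)
  exMiddle-valid (α ⟶ β) with exMiddle-valid β
  -- The value of the consequent passes to the implication: both clauses only ask that it persist to
  -- later worlds.
  ... | inj₁ b = inj₁ (λ w≤v _ → ⊩-mono β w≤v b)
  ... | inj₂ b = inj₂ (λ w≤v _ → ⊩⁻-mono β w≤v b)
  exMiddle-valid (~ α) = Sum.swap (exMiddle-valid α)

  peirceLaw-unprovable : ∀ {c} → ¬ HasPeirce c → ¬ Provable c peirceLaw
  peirceLaw-unprovable ¬h d =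
    -- The bottom world is `false`. There `var 0 ⟶ var 1` fails, since the top world `true` verifies
    -- `var 0` but not `var 1`; at the top `var 0` holds outright. So the law's premise is forced at
    -- the bottom, and soundness would give `var 0` there.
    sound (λ _ → exMiddle-valid) (λ h → contradiction h ¬h) {w = false} d [] b≤b
      (λ { {false} _ f → f f≤t tt ; {true} _ _ → tt })

-- The inclusion refuted runs from the calculus with the rule to the one without; `≐-sym` serves
-- when they come in the other order.
exMiddle-separates : ∀ {c d} → HasExMiddle c → ¬ HasExMiddle d →
                     ¬ (Provable c ≐ Provable d)
exMiddle-separates h ¬h (c⊆d , _) =
  Valueless.exMiddleLaw-unprovable ¬h (c⊆d (exMiddleLaw-provable h))

peirce-separates : ∀ {c d} → HasPeirce c → ¬ HasPeirce d →
                   ¬ (Provable c ≐ Provable d)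
peirce-separates h ¬h (c⊆d , _) =
  Chain.peirceLaw-unprovable ¬h (c⊆d (peirceLaw-provable h))

theorem2p7 : (c d : Calculus) → c ≢ d → ¬ (Provable c ≐ Provable d)
theorem2p7 sC  sC  c≢d = contradiction refl c≢d
theorem2p7 sC  sC3 _   = exMiddle-separates sC3 (λ ()) ∘ ≐-sym
theorem2p7 sC  sMC _   = peirce-separates sMC (λ ()) ∘ ≐-sym
theorem2p7 sC  sCN _   = peirce-separates sCN (λ ()) ∘ ≐-sym
theorem2p7 sC3 sC  _   = exMiddle-separates sC3 (λ ())
theorem2p7 sC3 sC3 c≢d = contradiction refl c≢d
-- `sC3` and `sMC` are incomparable: each proves a law that the other does not.
theorem2p7 sC3 sMC _   = exMiddle-separates sC3 (λ ())
theorem2p7 sC3 sCN _   = peirce-separates sCN (λ ()) ∘ ≐-sym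
theorem2p7 sMC sC  _   = peirce-separates sMC (λ ())
theorem2p7 sMC sC3 _   = peirce-separates sMC (λ ())
theorem2p7 sMC sMC c≢d = contradiction refl c≢d
theorem2p7 sMC sCN _   = exMiddle-separates sCN (λ ()) ∘ ≐-sym
theorem2p7 sCN sC  _   = peirce-separates sCN (λ ())
theorem2p7 sCN sC3 _   = peirce-separates sCN (λ ())
theorem2p7 sCN sMC _   = exMiddle-separates sCN (λ ())
theorem2p7 sCN sCN c≢d = contradiction refl c≢d
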